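{- The relation $E^{\mathrm{ce}}_{\min}$ is universal.
   Context: Fix a standard (acceptable) enumeration $(\varphi_e)_{e\in\omega}$ of the partial computable functions and let $W_e=\operatorname{dom}(\varphi_e)$. Write $e=^{\mathrm{ce}}e'$ iff $W_e=W_{e'}$. Define $e\mathrel{E^{\mathrm{ce}}_{\min}}e'$ iff $W_e=W_{e'}=\emptyset$, or $W_e,W_{e'}$ are both nonempty and $\min W_e=\min W_{e'}$. An enumeration of a set $A$ is a surjection $\mu:\omega\to A$; $\mu[s]$ denotes the finite string $\mu(0),\dots,\mu(s-1)$. A learner is an arbitrary function $\mathbf{M}:\omega^{<\omega}\to\omega$ (no effectivity is assumed). For an equivalence relation $E^{\mathrm{ce}}$ on $\omega$ extending $=^{\mathrm{ce}}$, a family $\mathfrak{K}$ of nonempty c.e. sets is $E^{\mathrm{ce}}$-learnable if there is a learner $\mathbf{M}$ such that for every $e$ with $W_e\in\mathfrak{K}$ and every enumeration $\mu$ of $W_e$ there is $i\in\omega$ with $i\mathrel{E^{\mathrm{ce}}}e$ and $\mathbf{M}(\mu[s])=i$ for all sufficiently large $s$. $E^{\mathrm{ce}}$ is universal if every family of nonempty c.e. sets is $E^{\mathrm{ce}}$-learnable. -}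

module Defs where

open import Axiom.ExcludedMiddle using (ExcludedMiddle)
open import Data.Fin using (Fin)
open import Data.List using (List; applyUpTo)
open import Data.Nat using (ℕ; zero; suc; _≤_; _<_)
open import Data.Nat.Induction using (<-rec)
open import Data.Nat.Properties using (≮⇒≥; ≤-antisym)
open import Data.Product using (Σ; ∃; ∃-syntax; _×_; _,_; swap)
open import Data.Sum using (_⊎_; inj₁; inj₂)
open import Data.Vec using (Vec; []; _∷_; lookup)
open import Data.Vec.Relation.Binary.Pointwise.Inductive using (Pointwise)
open import Level using (0ℓ; _⊔_) renaming (suc to lsuc)
open import Relation.Binary.Core using (Rel; _⇒_; _⇔_)
open import Relation.Binary.Definitions using (_Respects_)
open import Relation.Binary.PropositionalEquality using (_≡_; refl)
open import Relation.Binary.Structures using (IsEquivalence)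
open import Relation.Nullary using (yes; no; contradiction)
open import Relation.Unary using (Pred; _∈_; _≐_; Satisfiable; Empty)

-- Partial recursive functions of arity n.  They are partial, so their
-- semantics is the graph  c ⟨ xs ⟩⇓ y : "c halts on xs with value y".

data Code : ℕ → Set where
  zeroᶜ : ∀ {n} → Code n
  sucᶜ  : Code 1
  projᶜ : ∀ {n} → Fin n → Code n
  compᶜ : ∀ {m n} → Code m → Vec (Code n) m → Code n
  precᶜ : ∀ {n} → Code n → Code (suc (suc n)) → Code (suc n)
  muᶜ   : ∀ {n} → Code (suc n) → Code n

infix 4 _⟨_⟩⇓_

data _⟨_⟩⇓_ : ∀ {n} → Code n → Vec ℕ n → ℕ → Set where
  ⇓zero  : ∀ {n} {xs : Vec ℕ n} → zeroᶜ ⟨ xs ⟩⇓ 0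
  ⇓suc   : ∀ {x} → sucᶜ ⟨ x ∷ [] ⟩⇓ suc x
  ⇓proj  : ∀ {n} {i : Fin n} {xs} → projᶜ i ⟨ xs ⟩⇓ lookup xs i
  ⇓comp  : ∀ {m n} {f : Code m} {gs : Vec (Code n) m} {xs ys z} →
           Pointwise (λ g y → g ⟨ xs ⟩⇓ y) gs ys →
           f ⟨ ys ⟩⇓ z →
           compᶜ f gs ⟨ xs ⟩⇓ z
  ⇓prec₀ : ∀ {n} {f : Code n} {g xs y} →
           f ⟨ xs ⟩⇓ y →
           precᶜ f g ⟨ zero ∷ xs ⟩⇓ y
  ⇓precₛ : ∀ {n} {f : Code n} {g k xs y z} →
           precᶜ f g ⟨ k ∷ xs ⟩⇓ y →
           g ⟨ k ∷ y ∷ xs ⟩⇓ z →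
           precᶜ f g ⟨ suc k ∷ xs ⟩⇓ z
  ⇓mu    : ∀ {n} {f : Code (suc n)} {xs k} →
           f ⟨ k ∷ xs ⟩⇓ 0 →
           (∀ j → j < k → ∃[ v ] f ⟨ j ∷ xs ⟩⇓ suc v) →
           muᶜ f ⟨ xs ⟩⇓ k

PartialComputable : Pred (Rel ℕ 0ℓ) 0ℓ
PartialComputable ψ = Σ (Code 1) λ c → ψ ⇔ λ x y → c ⟨ x ∷ [] ⟩⇓ y

Computable : Pred (ℕ → ℕ) 0ℓ
Computable f = PartialComputable (λ x y → f x ≡ y)

-- Acceptable in the sense of Rogers: φ lists exactly the unary partial
-- computable functions (as graphs: φ e x y means φₑ(x) = y), has a
-- universal function, and satisfies the s-m-n property.

record AcceptableEnumeration : Set₁ where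
  field
    φ          : ℕ → Rel ℕ 0ℓ
    computable : ∀ e → PartialComputable (φ e)
    complete   : ∀ {ψ} → PartialComputable ψ → ∃[ e ] φ e ⇔ ψ
    universal  : Σ (Code 2) λ u →
                 ∀ e → φ e ⇔ λ x y → u ⟨ e ∷ x ∷ [] ⟩⇓ y
    smn        : ∀ (c : Code 2) → Σ (ℕ → ℕ) λ s → Computable s ×
                 ∀ e → φ (s e) ⇔ λ x y → c ⟨ e ∷ x ∷ [] ⟩⇓ y

IsMin : Pred ℕ 0ℓ → ℕ → Set
IsMin A m = m ∈ A × (∀ n → n ∈ A → m ≤ n)

minimum : ExcludedMiddle 0ℓ → ∀ {A} → Satisfiable A → ∃ (IsMin A)
minimum em {A} (n , n∈A) = <-rec (λ n → n ∈ A → ∃ (IsMin A)) step n n∈A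
  where
  step : ∀ n → (∀ {k} → k < n → k ∈ A → ∃ (IsMin A)) → n ∈ A → ∃ (IsMin A)
  step n rec n∈A with em {∃[ k ] k < n × k ∈ A}
  ... | yes (k , k<n , k∈A) = rec k<n k∈A
  ... | no none = n , n∈A , λ k k∈A → ≮⇒≥ λ k<n → none (k , k<n , k∈A)

record IsEnumeration (A : Pred ℕ 0ℓ) (μ : ℕ → ℕ) : Set where
  field
    into : ∀ n → μ n ∈ A
    onto : ∀ a → a ∈ A → ∃[ n ] μ n ≡ a

module Learning (Φ : AcceptableEnumeration) where
  open AcceptableEnumeration Φ

  W : ℕ → Pred ℕ 0ℓ
  W e x = ∃[ y ] φ e x y

  _=ᶜᵉ_ : Rel ℕ 0ℓ
  e =ᶜᵉ e′ = W e ≐ W e′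

  record CeEquivalence : Set₁ where
    field
      _~_           : Rel ℕ 0ℓ
      isEquivalence : IsEquivalence _~_
      extends       : _=ᶜᵉ_ ⇒ _~_

  -- Sets are predicates up to _≐_, so a family of sets must respect _≐_.

  record IsFamily {ℓ} (𝔎 : Pred (Pred ℕ 0ℓ) ℓ) : Set (lsuc 0ℓ ⊔ ℓ) where
    field
      respects : 𝔎 Respects _≐_
      nonempty : ∀ {A} → A ∈ 𝔎 → Satisfiable A
      ce       : ∀ {A} → A ∈ 𝔎 → ∃[ e ] A ≐ W e

  Learner : Set
  Learner = List ℕ → ℕ

  Learnable : ∀ {ℓ} → CeEquivalence → Pred (Pred ℕ 0ℓ) ℓ → Set ℓ
  Learnable E 𝔎 =
    Σ Learner λ M →
      ∀ e → W e ∈ 𝔎 → ∀ μ → IsEnumeration (W e) μ →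
      ∃[ i ] i ~ e × ∃[ s₀ ] (∀ s → s₀ ≤ s → M (applyUpTo μ s) ≡ i)
    where open CeEquivalence E

  Universal : ∀ ℓ → CeEquivalence → Set (lsuc 0ℓ ⊔ lsuc ℓ)
  Universal ℓ E = ∀ (𝔎 : Pred (Pred ℕ 0ℓ) ℓ) → IsFamily 𝔎 → Learnable E 𝔎

  _Eᵐⁱⁿ_ : Rel ℕ 0ℓ
  e Eᵐⁱⁿ e′ =
      (Empty (W e) × Empty (W e′))
    ⊎ (Satisfiable (W e) × Satisfiable (W e′) ×
       ∃[ m ] IsMin (W e) m × IsMin (W e′) m)

  -- Excluded middle is needed even for reflexivity: constructively, a c.e.
  -- set cannot be shown to be either empty or possessed of a least element.

  E-min : ExcludedMiddle 0ℓ → CeEquivalence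
  E-min em = record
    { _~_           = _Eᵐⁱⁿ_
    ; isEquivalence = record
      { refl  = λ {e} → ext {e} {e} ((λ p → p) , (λ p → p))
      ; sym   = λ {e} {e′} → symm {e} {e′}
      ; trans = λ {e} {e′} {e″} → tran {e} {e′} {e″}
      }
    ; extends       = λ {e} {e′} → ext {e} {e′}
    }
    where
    ext : ∀ {e e′} → e =ᶜᵉ e′ → e Eᵐⁱⁿ e′
    ext {e} {e′} (to , from) with em {Satisfiable (W e)}
    ... | no ∄    = inj₁ ((λ x x∈ → ∄ (x , x∈)) , (λ x x∈ → ∄ (x , from x∈)))
    ... | yes (x , x∈) with minimum em {W e} (x , x∈)
    ...   | m , m∈ , m≤ =
      inj₂ ((x , x∈) , (x , to x∈) ,
            m , (m∈ , m≤) , (to m∈ , λ n n∈ → m≤ n (from n∈)))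

    symm : ∀ {e e′} → e Eᵐⁱⁿ e′ → e′ Eᵐⁱⁿ e
    symm (inj₁ p)                     = inj₁ (swap p)
    symm (inj₂ (s , s′ , m , p , p′)) = inj₂ (s′ , s , m , p′ , p)

    tran : ∀ {e e′ e″} → e Eᵐⁱⁿ e′ → e′ Eᵐⁱⁿ e″ → e Eᵐⁱⁿ e″
    tran (inj₁ (∅ , _)) (inj₁ (_ , ∅″)) = inj₁ (∅ , ∅″)
    tran (inj₁ (_ , ∅′)) (inj₂ ((x , x∈) , _)) = contradiction x∈ (∅′ x)
    tran (inj₂ (_ , (x , x∈) , _)) (inj₁ (∅′ , _)) = contradiction x∈ (∅′ x)
    tran (inj₂ (s , _ , m , p , (m∈ , m≤)))
         (inj₂ (_ , s″ , n , (n∈ , n≤) , q))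
      with ≤-antisym (m≤ n n∈) (n≤ m m∈)
    ... | refl = inj₂ (s , s″ , m , p , q)

{-# OPTIONS --safe #-}

-- The learner conjectures a set whose minimum is the least number seen so far;
-- this stabilises once the enumeration has listed its least element.  For a
-- set with minimum m we take [m, ∞), the domain of an unbounded search.

module Submission where

open import Defs
open import Level using (0ℓ)
open import Axiom.ExcludedMiddle using (ExcludedMiddle)
open import Data.Fin using (zero; suc)
open import Data.List using ([]; _∷_; applyUpTo)
open import Data.List.Membership.Propositional.Properties using (∈-applyUpTo⁺)
open import Data.List.Relation.Unary.All.Properties using (applyUpTo⁺₂)
open import Data.Nat using (ℕ; zero; suc; _≤_; _<_; z≤n; s≤s)
open import Data.Nat.Properties using (≤-refl; ≤-totalOrder)
open import Data.List.Extrema ≤-totalOrder using (min; min≈v⁺)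
open import Data.Product using (∃-syntax; _×_; _,_; proj₁; proj₂)
open import Data.Sum using (inj₂)
open import Data.Vec using ([]; _∷_)
open import Data.Vec.Relation.Binary.Pointwise.Inductive using ([]; _∷_)
open import Function using (id)
open import Relation.Binary.PropositionalEquality using (_≡_; refl; cong)
open import Relation.Binary.Core using (_⇔_)
open import Relation.Unary using (_≐_)

-- The characteristic function of { x ∣ x < m }.
belowᶜ : ℕ → Code 1
belowᶜ zero    = zeroᶜ
belowᶜ (suc m) = precᶜ (compᶜ sucᶜ (zeroᶜ ∷ [])) (compᶜ (belowᶜ m) (projᶜ zero ∷ []))

-- The recursion only splits on `x`, but `⇓precₛ` still demands a value at the predecessor, which
-- the step function then discards. Totality supplies it.
belowᶜ-total : ∀ m x → ∃[ y ] belowᶜ m ⟨ x ∷ [] ⟩⇓ y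
belowᶜ-total zero    x       = 0 , ⇓zero
belowᶜ-total (suc m) zero    = 1 , ⇓prec₀ (⇓comp (⇓zero ∷ []) ⇓suc)
belowᶜ-total (suc m) (suc x) with belowᶜ-total (suc m) x | belowᶜ-total m x
... | _ , p | y , q = y , ⇓precₛ p (⇓comp (⇓proj ∷ []) q)

belowᶜ⇓0⁺ : ∀ {m x} → m ≤ x → belowᶜ m ⟨ x ∷ [] ⟩⇓ 0
belowᶜ⇓0⁺ z≤n = ⇓zero
belowᶜ⇓0⁺ {suc m} {suc x} (s≤s m≤x) =
  ⇓precₛ (proj₂ (belowᶜ-total (suc m) x)) (⇓comp (⇓proj ∷ []) (belowᶜ⇓0⁺ m≤x))

belowᶜ⇓0⁻ : ∀ m {x} → belowᶜ m ⟨ x ∷ [] ⟩⇓ 0 → m ≤ x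
belowᶜ⇓0⁻ zero    _ = z≤n
-- At argument 0 the value is a successor, hence not 0.
belowᶜ⇓0⁻ (suc m) (⇓prec₀ (⇓comp _ ()))
belowᶜ⇓0⁻ (suc m) (⇓precₛ _ (⇓comp (⇓proj ∷ []) h)) = s≤s (belowᶜ⇓0⁻ m h)

-- The search variable is ignored, so the search halts at once or never.
atLeastᶜ : ℕ → Code 1
atLeastᶜ m = muᶜ (compᶜ (belowᶜ m) (projᶜ (suc zero) ∷ []))

atLeastᶜ⇓⁺ : ∀ {m x} → m ≤ x → atLeastᶜ m ⟨ x ∷ [] ⟩⇓ 0
atLeastᶜ⇓⁺ m≤x = ⇓mu (⇓comp (⇓proj ∷ []) (belowᶜ⇓0⁺ m≤x)) λ _ ()

atLeastᶜ⇓⁻ : ∀ m {x y} → atLeastᶜ m ⟨ x ∷ [] ⟩⇓ y → m ≤ x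
atLeastᶜ⇓⁻ m (⇓mu (⇓comp (⇓proj ∷ []) h) _) = belowᶜ⇓0⁻ m h

module _ (Φ : AcceptableEnumeration) where
  open AcceptableEnumeration Φ
  open Learning Φ

  -- Learners are arbitrary functions, so it suffices to pick an index for each `m` separately.
  atLeast-φ : ∀ m → ∃[ e ] φ e ⇔ λ x y → atLeastᶜ m ⟨ x ∷ [] ⟩⇓ y
  atLeast-φ m = complete (atLeastᶜ m , id , id)

  atLeast : ℕ → ℕ
  atLeast m = proj₁ (atLeast-φ m)

  W-atLeast : ∀ m → W (atLeast m) ≐ (m ≤_)
  W-atLeast m =
    let _ , to , from = atLeast-φ m in
    (λ (_ , h) → atLeastᶜ⇓⁻ m (to h)) , (λ m≤x → 0 , from (atLeastᶜ⇓⁺ m≤x))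

  atLeast-Eᵐⁱⁿ : ∀ {m e} → IsMin (W e) m → atLeast m Eᵐⁱⁿ e
  atLeast-Eᵐⁱⁿ {m} isMin@(m∈ , _) =
    let to , from = W-atLeast m in
    inj₂ ((m , from ≤-refl) , (m , m∈) , m , (from ≤-refl , λ _ → to) , isMin)

  learner : Learner
  -- An arbitrary value: only long prefixes matter in the limit.
  learner []        = 0
  -- `min` wants a default value; `x` already occurs in `σ`, so it does not change the minimum.
  learner σ@(x ∷ _) = atLeast (min x σ)

proposition5p10 : (em : ExcludedMiddle 0ℓ) →
    (Φ : AcceptableEnumeration) →
    ∀ ℓ → Learning.Universal Φ ℓ (Learning.E-min Φ em)
proposition5p10 em Φ ℓ 𝔎 _ = learner Φ , learns
  where
  open Learning Φ

  learns : ∀ e → 𝔎 (W e) → ∀ μ → IsEnumeration (W e) μ →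
    ∃[ i ] i Eᵐⁱⁿ e × ∃[ s₀ ] (∀ s → s₀ ≤ s → learner Φ (applyUpTo μ s) ≡ i)
  learns e _ μ enum with minimum em (μ 0 , IsEnumeration.into enum 0)
  ... | m , isMin@(m∈ , m≤) with IsEnumeration.onto enum m m∈
  -- Here `m` is `μ k`, and position `k` lies in a prefix exactly when its length is at least
  -- `suc k`.
  ...   | k , refl = _ , atLeast-Eᵐⁱⁿ Φ isMin , suc k , stable
    where
    m≤μ : ∀ n → m ≤ μ n
    m≤μ n = m≤ (μ n) (IsEnumeration.into enum n)

    stable : ∀ s → k < s → learner Φ (applyUpTo μ s) ≡ atLeast Φ m
    -- Since `k < s`, the prefix is nonempty and its default is `μ 0`. It contains `m`, which bounds
    -- both its entries and the default from below.
    stable s@(suc _) k<s = cong (atLeast Φ)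
      (min≈v⁺ (∈-applyUpTo⁺ μ k<s) (applyUpTo⁺₂ μ s m≤μ) (m≤μ 0))
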